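{- Over $\mathrm{HA}^\omega+\mathrm{BI}+\mathrm{CONT}$ (with $R$ ranging over discrete types), the dependent iterated skewed product $\mathsf{MBR}$ and modified bar recursion $\mathsf{MBR}'$ are $T$-equivalent: $\mathsf{MBR}=_T\mathsf{MBR}'$, i.e. $\mathsf{MBR}\ge_T\mathsf{MBR}'$ and $\mathsf{MBR}'\ge_T\mathsf{MBR}$.
   Context: Types and systems. Finite types are generated from $\mathbb{B}$ (booleans) and $\mathbb{N}$ by $X\times Y$, $X\to Y$ and $X^*$ (finite sequences). For a sequence of types $(X_i)_{i\in\mathbb{N}}$, $\Pi_i X_i$ is the type of infinite sequences whose $i$-th entry is in $X_i$ and $\Pi_{i<n}X_i$ the type of finite sequences of length $n$. (This is used for readability; one may take all $X_i$ equal to one type $X$, reading $\Pi_iX_i$ as $\mathbb{N}\to X$ and finite sequence types as $X^*$.) $\mathrm{HA}^\omega$ is Heyting arithmetic in all finite types with fully extensional equality (Troelstra's E-$\mathrm{HA}^\omega$); system $T$ is its quantifier-free fragment (Gödel's primitive recursive functionals). Notation. $*$ is concatenation; $|s|$ is the length of $s$; $q_x(\alpha)=q(x*\alpha)$; $[\alpha](n)=\langle\alpha(0),\dots,\alpha(n-1)\rangle$. $T$-definability. A functional is specified by a defining equation (for each choice of type parameters). $G$ is $T$-definable from $F$ over a theory $\mathcal{S}$ (written $F\ge_T G$) if for each choice of types for $G$ there are a choice of types for $F$ and a term $s$ of system $T$ such that $s(F)$ satisfies the defining equation of $G$, provably in $\mathcal{S}$ together with the defining equation of $F$. In both definitions,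 $\varepsilon_s\colon(X_{|s|}\to R)\to\Pi_iX_{i+|s|}$ is a family indexed by finite sequences $s\colon\Pi_{i<|s|}X_i$. $\mathsf{MBR}$. For $q\colon\Pi_iX_{i+|s|}\to R$, $\mathsf{MBR}_s(\varepsilon)(q)\colon\Pi_iX_{i+|s|}$ is specified by $\mathsf{MBR}_s(\varepsilon)(q)=\varepsilon_s(\lambda x.\,q_x(\mathsf{MBR}_{s*x}(\varepsilon)(q_x)))$. $\mathsf{MBR}'$. For $q\colon\Pi_iX_i\to R$, $\mathsf{MBR}'_s(\varepsilon)(q)\colon\Pi_iX_i$ is specified by $\mathsf{MBR}'_s(\varepsilon)(q)=s*\varepsilon_s(\lambda x^{X_{|s|}}.\,q(\mathsf{MBR}'_{s*x}(\varepsilon)(q)))$. $\mathrm{CONT}$: for discrete $R$, $\forall q^{\Pi_iX_i\to R}\,\forall\alpha\,\exists n\,\forall\beta\,([\alpha](n)=[\beta](n)\to q(\alpha)=q(\beta))$. Discrete and compact types are generated by: compact $::=\mathbb{B}\mid$ compact $\times$ compact $\mid$ discrete $\to$ compact; discrete $::=\mathbb{B}\mid\mathbb{N}\mid$ discrete $\times$ discrete $\mid$ discrete$^*$ $\mid$ compact $\to$ discrete. $\mathrm{BI}$ (relativised bar induction) is the scheme, for arbitrary predicates $S,P$ on finite sequences: if $S(\langle\rangle)$, and for every infinite $\alpha$ with $S([\alpha](n))$ for all $n$ there is $n$ with $P([\alpha](n))$, and for all $s$ with $S(s)$: $\forall x[S(s*x)\to P(s*x)]\to P(s)$; then $P(\langle\rangle)$.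 -}

module Defs where

open import Data.Fin.Base using (Fin)
open import Data.Fin.Patterns using (0F; 1F; 2F; 3F; 4F)
open import Data.List.Base using (List; []; _∷_; length; lookup; map)
open import Data.List.Membership.Propositional using (_∈_)
open import Data.List.Membership.Propositional.Properties using (∈-lookup)
open import Data.List.Relation.Unary.Any using (here; there)
open import Data.Product.Base using (Σ; Σ-syntax; _×_; _,_)
open import Data.Sum.Base using (_⊎_)
open import Relation.Binary.PropositionalEquality.Core using (refl)

infixr 7 _⇒_
infixr 8 _⊗_
infix  9 _✶

data Ty : Set where
  𝔹 𝕟     : Ty
  _⊗_ _⇒_ : Ty → Ty → Ty
  _✶      : Ty → Ty

mutual
  data Compact : Ty → Set where
    𝔹-compact : Compact 𝔹
    ⊗-compact : ∀ {σ τ} → Compact σ → Compact τ → Compact (σ ⊗ τ)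
    ⇒-compact : ∀ {σ τ} → Discrete σ → Compact τ → Compact (σ ⇒ τ)

  data Discrete : Ty → Set where
    𝔹-discrete : Discrete 𝔹
    𝕟-discrete : Discrete 𝕟
    ⊗-discrete : ∀ {σ τ} → Discrete σ → Discrete τ → Discrete (σ ⊗ τ)
    ✶-discrete : ∀ {σ} → Discrete σ → Discrete (σ ✶)
    ⇒-discrete : ∀ {σ τ} → Compact σ → Discrete τ → Discrete (σ ⇒ τ)

------------------------------------------------------------------------
-- Terms of system T

-- The head of a context is the innermost variable.
Ctx : Set
Ctx = List Ty

infixl 20 _·_

-- 𝕟-rec and ✶-rec take their arguments in the order: base, step, object
-- recursed upon; 𝔹-rec in the order: value at true, value at false, boolean.
data Tm (Γ : Ctx) : Ty → Set where
  var   : ∀ {σ} → σ ∈ Γ → Tm Γ σ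
  ƛ_    : ∀ {σ τ} → Tm (σ ∷ Γ) τ → Tm Γ (σ ⇒ τ)
  _·_   : ∀ {σ τ} → Tm Γ (σ ⇒ τ) → Tm Γ σ → Tm Γ τ
  tt ff : Tm Γ 𝔹
  𝔹-rec : ∀ {τ} → Tm Γ (τ ⇒ τ ⇒ 𝔹 ⇒ τ)
  zero  : Tm Γ 𝕟
  suc   : Tm Γ (𝕟 ⇒ 𝕟)
  𝕟-rec : ∀ {τ} → Tm Γ (τ ⇒ (𝕟 ⇒ τ ⇒ τ) ⇒ 𝕟 ⇒ τ)
  pair  : ∀ {σ τ} → Tm Γ (σ ⇒ τ ⇒ σ ⊗ τ)
  fst   : ∀ {σ τ} → Tm Γ (σ ⊗ τ ⇒ σ)
  snd   : ∀ {σ τ} → Tm Γ (σ ⊗ τ ⇒ τ)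
  nil   : ∀ {σ} → Tm Γ (σ ✶)
  cons  : ∀ {σ} → Tm Γ (σ ⇒ σ ✶ ⇒ σ ✶)
  ✶-rec : ∀ {σ τ} → Tm Γ (τ ⇒ (σ ⇒ σ ✶ ⇒ τ ⇒ τ) ⇒ σ ✶ ⇒ τ)

infixr 5 ƛ_

# : ∀ {Γ} (i : Fin (length Γ)) → Tm Γ (lookup Γ i)
# i = var (∈-lookup i)

Ren : Ctx → Ctx → Set
Ren Γ Δ = ∀ {σ} → σ ∈ Γ → σ ∈ Δ

Sub : Ctx → Ctx → Set
Sub Γ Δ = ∀ {σ} → σ ∈ Γ → Tm Δ σ

↑⁰ : ∀ {Γ} → Ren Γ Γ
↑⁰ x = x

↑¹ : ∀ {Γ σ} → Ren Γ (σ ∷ Γ)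
↑¹ = there

↑² : ∀ {Γ σ τ} → Ren Γ (τ ∷ σ ∷ Γ)
↑² x = there (there x)

extᵣ : ∀ {Γ Δ σ} → Ren Γ Δ → Ren (σ ∷ Γ) (σ ∷ Δ)
extᵣ ρ (here e)  = here e
extᵣ ρ (there x) = there (ρ x)

ren : ∀ {Γ Δ σ} → Ren Γ Δ → Tm Γ σ → Tm Δ σ
ren ρ (var x) = var (ρ x)
ren ρ (ƛ t)   = ƛ ren (extᵣ ρ) t
ren ρ (t · u) = ren ρ t · ren ρ u
ren ρ tt      = tt
ren ρ ff      = ff
ren ρ 𝔹-rec   = 𝔹-rec
ren ρ zero    = zero
ren ρ suc     = suc
ren ρ 𝕟-rec   = 𝕟-rec
ren ρ pair    = pair
ren ρ fst     = fst
ren ρ snd     = snd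
ren ρ nil     = nil
ren ρ cons    = cons
ren ρ ✶-rec   = ✶-rec

wk : ∀ {Γ σ τ} → Tm Γ τ → Tm (σ ∷ Γ) τ
wk = ren ↑¹

closed : ∀ {Γ σ} → Tm [] σ → Tm Γ σ
closed = ren λ ()

extₛ : ∀ {Γ Δ σ} → Sub Γ Δ → Sub (σ ∷ Γ) (σ ∷ Δ)
extₛ ς (here e)  = var (here e)
extₛ ς (there x) = wk (ς x)

sub : ∀ {Γ Δ σ} → Sub Γ Δ → Tm Γ σ → Tm Δ σ
sub ς (var x) = ς x
sub ς (ƛ t)   = ƛ sub (extₛ ς) t
sub ς (t · u) = sub ς t · sub ς u
sub ς tt      = tt
sub ς ff      = ff
sub ς 𝔹-rec   = 𝔹-rec
sub ς zero    = zero
sub ς suc     = suc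
sub ς 𝕟-rec   = 𝕟-rec
sub ς pair    = pair
sub ς fst     = fst
sub ς snd     = snd
sub ς nil     = nil
sub ς cons    = cons
sub ς ✶-rec   = ✶-rec

-- Rename all variables but the innermost, which is replaced by the term.
_↦_ : ∀ {Γ Δ σ} → Ren Γ Δ → Tm Δ σ → Sub (σ ∷ Γ) Δ
(ρ ↦ t) (here refl) = t
(ρ ↦ t) (there x)   = var (ρ x)

_[_] : ∀ {Γ σ τ} → Tm (σ ∷ Γ) τ → Tm Γ σ → Tm Γ τ
t [ u ] = sub (↑⁰ ↦ u) t

------------------------------------------------------------------------
-- Sequences.  The types X i are all taken equal to a single X, so that
-- Π i. X i is 𝕟 ⇒ X and the finite sequences form X ✶.

infixr 12 _◂_ _⊛_
infixl 12 _∷ʳ_ _++_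

-- x * α for an element x and an infinite sequence α
_◂_ : ∀ {Γ X} → Tm Γ X → Tm Γ (𝕟 ⇒ X) → Tm Γ (𝕟 ⇒ X)
x ◂ α = (ƛ ƛ ƛ 𝕟-rec · # 2F · (ƛ ƛ # 3F · # 1F) · # 0F) · x · α

-- s * α for a finite sequence s and an infinite sequence α
_⊛_ : ∀ {Γ X} → Tm Γ (X ✶) → Tm Γ (𝕟 ⇒ X) → Tm Γ (𝕟 ⇒ X)
s ⊛ α = ✶-rec · α · (ƛ ƛ ƛ # 2F ◂ # 0F) · s

-- s * t for finite sequences s and t
_++_ : ∀ {Γ X} → Tm Γ (X ✶) → Tm Γ (X ✶) → Tm Γ (X ✶)
s ++ t = ✶-rec · t · (ƛ ƛ ƛ cons · # 2F · # 0F) · s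

-- s * x for a finite sequence s and an element x
_∷ʳ_ : ∀ {Γ X} → Tm Γ (X ✶) → Tm Γ X → Tm Γ (X ✶)
s ∷ʳ x = s ++ (cons · x · nil)

-- [α](n)
initial : ∀ {Γ X} → Tm Γ (𝕟 ⇒ X) → Tm Γ 𝕟 → Tm Γ (X ✶)
initial α n = (ƛ 𝕟-rec · nil · (ƛ ƛ # 0F ∷ʳ (# 2F · # 1F))) · α · n

-- q_x, i.e. λ α. q (x * α)
_after_ : ∀ {Γ X R} → Tm Γ ((𝕟 ⇒ X) ⇒ R) → Tm Γ X → Tm Γ ((𝕟 ⇒ X) ⇒ R)
q after x = ƛ wk q · (wk x ◂ # 0F)

------------------------------------------------------------------------
-- Formulas

infix  10 _≈_
infixr 7  _∧_
infixr 6  _∨_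
infixr 5  _⊃_

data Formula (Γ : Ctx) : Set where
  _≈_         : ∀ {σ} → Tm Γ σ → Tm Γ σ → Formula Γ
  ⊥           : Formula Γ
  _∧_ _∨_ _⊃_ : Formula Γ → Formula Γ → Formula Γ
  all ex      : ∀ σ → Formula (σ ∷ Γ) → Formula Γ

subF : ∀ {Γ Δ} → Sub Γ Δ → Formula Γ → Formula Δ
subF ς (t ≈ u)   = sub ς t ≈ sub ς u
subF ς ⊥         = ⊥
subF ς (φ ∧ ψ)   = subF ς φ ∧ subF ς ψ
subF ς (φ ∨ ψ)   = subF ς φ ∨ subF ς ψ
subF ς (φ ⊃ ψ)   = subF ς φ ⊃ subF ς ψ
subF ς (all σ φ) = all σ (subF (extₛ ς) φ)
subF ς (ex σ φ)  = ex σ (subF (extₛ ς) φ)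

wkF : ∀ {Γ σ} → Formula Γ → Formula (σ ∷ Γ)
wkF = subF λ x → var (there x)

infix 15 _[_∣_] _⟦_⟧

-- φ with its innermost variable replaced by a term living in an extension
-- of the context of the other variables; the renaming is that extension.
_[_∣_] : ∀ {Γ Δ σ} → Formula (σ ∷ Γ) → Ren Γ Δ → Tm Δ σ → Formula Δ
φ [ ρ ∣ t ] = subF (ρ ↦ t) φ

_⟦_⟧ : ∀ {Γ σ} → Formula (σ ∷ Γ) → Tm Γ σ → Formula Γ
φ ⟦ t ⟧ = φ [ ↑⁰ ∣ t ]

------------------------------------------------------------------------
-- Intuitionistic many-sorted predicate logic with equality, over the axioms
-- of a theory.  Free variables are allowed in axioms, and stand for
-- parameters.

Theory : Set₁
Theory = (Γ : Ctx) → Formula Γ → Set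

infixr 6 _∪_

_∪_ : Theory → Theory → Theory
(𝒮 ∪ 𝒯) Γ φ = 𝒮 Γ φ ⊎ 𝒯 Γ φ

infix 3 _∣_⊢_

data _∣_⊢_ (𝒮 : Theory) {Γ : Ctx} (Φ : List (Formula Γ)) : Formula Γ → Set where
  axiom : ∀ {φ} → 𝒮 Γ φ → 𝒮 ∣ Φ ⊢ φ
  hyp   : ∀ {φ} → φ ∈ Φ → 𝒮 ∣ Φ ⊢ φ
  ⊥-e   : ∀ {φ} → 𝒮 ∣ Φ ⊢ ⊥ → 𝒮 ∣ Φ ⊢ φ
  ∧-i   : ∀ {φ ψ} → 𝒮 ∣ Φ ⊢ φ → 𝒮 ∣ Φ ⊢ ψ → 𝒮 ∣ Φ ⊢ φ ∧ ψ
  ∧-e₁  : ∀ {φ ψ} → 𝒮 ∣ Φ ⊢ φ ∧ ψ → 𝒮 ∣ Φ ⊢ φ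
  ∧-e₂  : ∀ {φ ψ} → 𝒮 ∣ Φ ⊢ φ ∧ ψ → 𝒮 ∣ Φ ⊢ ψ
  ∨-i₁  : ∀ {φ ψ} → 𝒮 ∣ Φ ⊢ φ → 𝒮 ∣ Φ ⊢ φ ∨ ψ
  ∨-i₂  : ∀ {φ ψ} → 𝒮 ∣ Φ ⊢ ψ → 𝒮 ∣ Φ ⊢ φ ∨ ψ
  ∨-e   : ∀ {φ ψ χ} → 𝒮 ∣ Φ ⊢ φ ∨ ψ → 𝒮 ∣ φ ∷ Φ ⊢ χ → 𝒮 ∣ ψ ∷ Φ ⊢ χ → 𝒮 ∣ Φ ⊢ χ
  ⊃-i   : ∀ {φ ψ} → 𝒮 ∣ φ ∷ Φ ⊢ ψ → 𝒮 ∣ Φ ⊢ φ ⊃ ψ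
  ⊃-e   : ∀ {φ ψ} → 𝒮 ∣ Φ ⊢ φ ⊃ ψ → 𝒮 ∣ Φ ⊢ φ → 𝒮 ∣ Φ ⊢ ψ
  all-i : ∀ {σ φ} → 𝒮 ∣ map wkF Φ ⊢ φ → 𝒮 ∣ Φ ⊢ all σ φ
  all-e : ∀ {σ φ} → 𝒮 ∣ Φ ⊢ all σ φ → (t : Tm Γ σ) → 𝒮 ∣ Φ ⊢ φ ⟦ t ⟧
  ex-i  : ∀ {σ φ} (t : Tm Γ σ) → 𝒮 ∣ Φ ⊢ φ ⟦ t ⟧ → 𝒮 ∣ Φ ⊢ ex σ φ
  ex-e  : ∀ {σ φ ψ} → 𝒮 ∣ Φ ⊢ ex σ φ → 𝒮 ∣ φ ∷ map wkF Φ ⊢ wkF ψ → 𝒮 ∣ Φ ⊢ ψ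
  ≈-i   : ∀ {σ} {t : Tm Γ σ} → 𝒮 ∣ Φ ⊢ t ≈ t
  ≈-e   : ∀ {σ} (φ : Formula (σ ∷ Γ)) {t u : Tm Γ σ} →
          𝒮 ∣ Φ ⊢ t ≈ u → 𝒮 ∣ Φ ⊢ φ ⟦ t ⟧ → 𝒮 ∣ Φ ⊢ φ ⟦ u ⟧

------------------------------------------------------------------------
-- E-HA^ω: equality is primitive at every type, and extensional at function
-- types by ext.  Disjointness and injectivity of the constructors of 𝔹 and
-- _✶ follow from those of 𝕟 by means of the recursors.

data HAω (Γ : Ctx) : Formula Γ → Set where
  β       : ∀ {σ τ} (t : Tm (σ ∷ Γ) τ) (u : Tm Γ σ) → HAω Γ ((ƛ t) · u ≈ t [ u ])
  ext     : ∀ {σ τ} (f g : Tm Γ (σ ⇒ τ)) →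
            HAω Γ (all σ (wk f · # 0F ≈ wk g · # 0F) ⊃ f ≈ g)

  𝔹-rec-tt : ∀ {τ} (a b : Tm Γ τ) → HAω Γ (𝔹-rec · a · b · tt ≈ a)
  𝔹-rec-ff : ∀ {τ} (a b : Tm Γ τ) → HAω Γ (𝔹-rec · a · b · ff ≈ b)
  𝔹-ind    : (φ : Formula (𝔹 ∷ Γ)) → HAω Γ (φ ⟦ tt ⟧ ⊃ φ ⟦ ff ⟧ ⊃ all 𝔹 φ)

  suc≉zero   : (n : Tm Γ 𝕟) → HAω Γ (suc · n ≈ zero ⊃ ⊥)
  suc-inj    : (m n : Tm Γ 𝕟) → HAω Γ (suc · m ≈ suc · n ⊃ m ≈ n)
  𝕟-rec-zero : ∀ {τ} (a : Tm Γ τ) (f : Tm Γ (𝕟 ⇒ τ ⇒ τ)) →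
               HAω Γ (𝕟-rec · a · f · zero ≈ a)
  𝕟-rec-suc  : ∀ {τ} (a : Tm Γ τ) (f : Tm Γ (𝕟 ⇒ τ ⇒ τ)) (n : Tm Γ 𝕟) →
               HAω Γ (𝕟-rec · a · f · (suc · n) ≈ f · n · (𝕟-rec · a · f · n))
  𝕟-ind      : (φ : Formula (𝕟 ∷ Γ)) →
               HAω Γ (φ ⟦ zero ⟧ ⊃ all 𝕟 (φ ⊃ φ [ ↑¹ ∣ suc · # 0F ]) ⊃ all 𝕟 φ)

  fst-pair : ∀ {σ τ} (t : Tm Γ σ) (u : Tm Γ τ) → HAω Γ (fst · (pair · t · u) ≈ t)
  snd-pair : ∀ {σ τ} (t : Tm Γ σ) (u : Tm Γ τ) → HAω Γ (snd · (pair · t · u) ≈ u)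
  pair-η   : ∀ {σ τ} (p : Tm Γ (σ ⊗ τ)) → HAω Γ (pair · (fst · p) · (snd · p) ≈ p)

  ✶-rec-nil  : ∀ {σ τ} (a : Tm Γ τ) (f : Tm Γ (σ ⇒ σ ✶ ⇒ τ ⇒ τ)) →
               HAω Γ (✶-rec · a · f · nil ≈ a)
  ✶-rec-cons : ∀ {σ τ} (a : Tm Γ τ) (f : Tm Γ (σ ⇒ σ ✶ ⇒ τ ⇒ τ))
               (x : Tm Γ σ) (s : Tm Γ (σ ✶)) →
               HAω Γ (✶-rec · a · f · (cons · x · s) ≈ f · x · s · (✶-rec · a · f · s))
  ✶-ind      : ∀ {σ} (φ : Formula (σ ✶ ∷ Γ)) →
               HAω Γ (φ ⟦ nil ⟧ ⊃
                      all (σ ✶) (φ ⊃ all σ (φ [ ↑² ∣ cons · # 0F · # 1F ])) ⊃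
                      all (σ ✶) φ)

data BI (Γ : Ctx) : Formula Γ → Set where
  bi : ∀ {X} (S P : Formula (X ✶ ∷ Γ)) →
       BI Γ (S ⟦ nil ⟧ ⊃
             all (𝕟 ⇒ X) (all 𝕟 (S [ ↑² ∣ initial (# 1F) (# 0F) ]) ⊃
                          ex  𝕟 (P [ ↑² ∣ initial (# 1F) (# 0F) ])) ⊃
             all (X ✶) (S ⊃
                        all X (S [ ↑² ∣ # 1F ∷ʳ # 0F ] ⊃ P [ ↑² ∣ # 1F ∷ʳ # 0F ]) ⊃
                        P) ⊃
             P ⟦ nil ⟧)

-- The quantified variables are q, α, n, β, from the outermost inwards.
data CONT (Γ : Ctx) : Formula Γ → Set where
  cont : ∀ {X R} → Discrete R →
         CONT Γ (all ((𝕟 ⇒ X) ⇒ R) (all (𝕟 ⇒ X) (ex 𝕟 (all (𝕟 ⇒ X)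
                   (initial (# 2F) (# 1F) ≈ initial (# 0F) (# 1F) ⊃
                    # 3F · # 2F ≈ # 3F · # 0F)))))

------------------------------------------------------------------------
-- T-definability

-- For each choice of type parameters, the type of the functional and its
-- defining equation, whose only free variable stands for the functional.
record Functional : Set₁ where
  field
    Param    : Set
    type     : Param → Ty
    equation : (p : Param) → Formula (type p ∷ [])

open Functional public

-- F ≥T G over 𝒮.  F is a free variable of the derivation, which makes it a
-- fresh constant: it may occur in instances of the schemata of 𝒮.
_≥T_over_ : Functional → Functional → Theory → Set
F ≥T G over 𝒮 =
  (g : Param G) → Σ[ f ∈ Param F ] Σ[ s ∈ Tm [] (type F f ⇒ type G g) ]
    (𝒮 ∣ equation F f ∷ [] ⊢ equation G g [ (λ ()) ∣ closed s · # 0F ])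

_=T_over_ : Functional → Functional → Theory → Set
F =T G over 𝒮 = F ≥T G over 𝒮 × G ≥T F over 𝒮

------------------------------------------------------------------------
-- The two functionals

record Types : Set where
  constructor types
  field
    X R        : Ty
    R-discrete : Discrete R

-- The type of both functionals: the arguments are s, ε and q.
BRType : Types → Ty
BRType (types X R _) =
  X ✶ ⇒ (X ✶ ⇒ (X ⇒ R) ⇒ (𝕟 ⇒ X)) ⇒ ((𝕟 ⇒ X) ⇒ R) ⇒ (𝕟 ⇒ X)

-- In both equations, the variables outside λ x are
-- # 3F = the functional, # 2F = s, # 1F = ε, # 0F = q,
-- and those inside it are
-- # 4F = the functional, # 3F = s, # 2F = ε, # 1F = q, # 0F = x.

MBR : Functional
MBR .Param = Types
MBR .type  = BRType
MBR .equation (types X R _) =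
  all (X ✶) (all (X ✶ ⇒ (X ⇒ R) ⇒ (𝕟 ⇒ X)) (all ((𝕟 ⇒ X) ⇒ R)
    (# 3F · # 2F · # 1F · # 0F
       ≈ # 1F · # 2F ·
         (ƛ (# 1F after # 0F) ·
            (# 4F · (# 3F ∷ʳ # 0F) · # 2F · (# 1F after # 0F))))))

MBR′ : Functional
MBR′ .Param = Types
MBR′ .type  = BRType
MBR′ .equation (types X R _) =
  all (X ✶) (all (X ✶ ⇒ (X ⇒ R) ⇒ (𝕟 ⇒ X)) (all ((𝕟 ⇒ X) ⇒ R)
    (# 3F · # 2F · # 1F · # 0F
       ≈ # 2F ⊛
         (# 1F · # 2F ·
          (ƛ # 1F · (# 4F · (# 3F ∷ʳ # 0F) · # 2F · # 1F))))))

{-# OPTIONS --safe #-}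

-- Writing q_s for λ α. q (s * α), one puts MBR′_s(ε)(q) = s * MBR_s(ε)(q_s);
-- the equation follows from that of MBR since (q_s)_x = q_{s*x}.
-- Conversely, with δ_s removing the first |s| entries of a sequence, one puts
-- MBR_s(ε)(q) = δ_s (MBR′_s(ε)(q ∘ δ_s)).  Here the recursive call uses
-- q_x ∘ δ_{s*x} where the equation of MBR′ provides q ∘ δ_s.  These two agree
-- on all extensions of s * x, and BI and CONT show that MBR′_t(ε)(q) depends
-- only on the values of q at extensions of t.

module Submission where

open import Data.Fin.Base using (Fin)
open import Data.Fin.Patterns using (0F; 1F; 2F; 3F; 4F; 5F; 6F; 7F)
open import Data.List.Base using (List; []; _∷_; length; lookup; map)
open import Data.List.Membership.Propositional using (_∈_)
open import Data.List.Membership.Propositional.Properties using (∈-lookup)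
open import Data.List.Relation.Unary.Any using (here; there)
open import Data.Nat.Base using (ℕ; zero; suc)
open import Data.Product.Base using (Σ-syntax; _,_; proj₁; proj₂)
open import Data.Sum.Base using (inj₁; inj₂)
open import Relation.Binary.PropositionalEquality
  using (_≡_; refl; sym; cong; cong₂; subst; subst₂)

open import Defs

private variable
  Γ Δ     : Ctx
  σ τ X R : Ty
  𝒮       : Theory
  Φ       : List (Formula Γ)
  φ ψ     : Formula Γ
  t u v f g : Tm Γ σ

infixl 4 _at_

-- Derived rules and substitution

assume : (i : Fin (length Φ)) → 𝒮 ∣ Φ ⊢ lookup Φ i
assume i = hyp (∈-lookup i)

-- Making a derived fact a hypothesis keeps it usable under `all-i` and `⊃-i`, which transport the
-- formulas of `Φ` but not derivations over `Φ`.
cut : 𝒮 ∣ Φ ⊢ φ → 𝒮 ∣ φ ∷ Φ ⊢ ψ → 𝒮 ∣ Φ ⊢ ψ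
cut p q = ⊃-e (⊃-i q) p

_at_ : {φ : Formula (σ ∷ Γ)} → 𝒮 ∣ Φ ⊢ all σ φ → (t : Tm Γ σ) → 𝒮 ∣ Φ ⊢ φ ⟦ t ⟧
_at_ = all-e

-- The pointwise hypothesis passes to the extended `ρ` and `ς` under `ƛ` without function
-- extensionality.
sub-ren-id : {ρ : Ren Γ Δ} {ς : Sub Δ Γ} →
             (∀ {σ} (x : σ ∈ Γ) → ς (ρ x) ≡ var x) →
             (t : Tm Γ τ) → sub ς (ren ρ t) ≡ t
sub-ren-id e (var x) = e x
sub-ren-id e (ƛ t)   = cong ƛ_ (sub-ren-id
  (λ { (here _) → refl ; (there x) → cong wk (e x) }) t)
sub-ren-id e (t · u) = cong₂ _·_ (sub-ren-id e t) (sub-ren-id e u)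
sub-ren-id e tt      = refl
sub-ren-id e ff      = refl
sub-ren-id e 𝔹-rec   = refl
sub-ren-id e zero    = refl
sub-ren-id e suc     = refl
sub-ren-id e 𝕟-rec   = refl
sub-ren-id e pair    = refl
sub-ren-id e fst     = refl
sub-ren-id e snd     = refl
sub-ren-id e nil     = refl
sub-ren-id e cons    = refl
sub-ren-id e ✶-rec   = refl

wk-[] : (t : Tm Γ τ) (u : Tm Γ σ) → wk t [ u ] ≡ t
wk-[] t u = sub-ren-id (λ _ → refl) t

-- Equational reasoning

≈-cong : (C : Tm (σ ∷ Γ) τ) → 𝒮 ∣ Φ ⊢ t ≈ u → 𝒮 ∣ Φ ⊢ C [ t ] ≈ C [ u ]
≈-cong {t = t} {u = u} C p =
  subst (λ v → _ ∣ _ ⊢ v ≈ C [ u ]) (wk-[] (C [ t ]) u)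
    (≈-e (wk (C [ t ]) ≈ C) p
      (subst (λ v → _ ∣ _ ⊢ v ≈ C [ t ]) (sym (wk-[] (C [ t ]) t)) ≈-i))

≈-sym : 𝒮 ∣ Φ ⊢ t ≈ u → 𝒮 ∣ Φ ⊢ u ≈ t
≈-sym {t = t} {u = u} p =
  subst (λ v → _ ∣ _ ⊢ u ≈ v) (wk-[] t u)
    (≈-e (# 0F ≈ wk t) p (subst (λ v → _ ∣ _ ⊢ t ≈ v) (sym (wk-[] t t)) ≈-i))

≈-trans : 𝒮 ∣ Φ ⊢ t ≈ u → 𝒮 ∣ Φ ⊢ u ≈ v → 𝒮 ∣ Φ ⊢ t ≈ v
≈-trans {t = t} {u = u} {v = v} p q =
  subst (λ w → _ ∣ _ ⊢ w ≈ v) (wk-[] t v)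
    (≈-e (wk t ≈ # 0F) q (subst (λ w → _ ∣ _ ⊢ w ≈ u) (sym (wk-[] t u)) p))

·-congˡ : (f : Tm Γ (σ ⇒ τ)) → 𝒮 ∣ Φ ⊢ t ≈ u → 𝒮 ∣ Φ ⊢ f · t ≈ f · u
·-congˡ {t = t} {u = u} f p =
  subst₂ (λ f₁ f₂ → _ ∣ _ ⊢ f₁ · t ≈ f₂ · u) (wk-[] f t) (wk-[] f u)
    (≈-cong (wk f · # 0F) p)

·-congʳ : (t : Tm Γ σ) → 𝒮 ∣ Φ ⊢ f ≈ g → 𝒮 ∣ Φ ⊢ f · t ≈ g · t
·-congʳ {f = f} {g = g} t p =
  subst₂ (λ t₁ t₂ → _ ∣ _ ⊢ f · t₁ ≈ g · t₂) (wk-[] t f) (wk-[] t g)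
    (≈-cong (# 0F · wk t) p)

·-cong : 𝒮 ∣ Φ ⊢ f ≈ g → 𝒮 ∣ Φ ⊢ t ≈ u → 𝒮 ∣ Φ ⊢ f · t ≈ g · u
·-cong p q = ≈-trans (·-congʳ _ p) (·-congˡ _ q)

ha : HAω Γ φ → (HAω ∪ 𝒮) ∣ Φ ⊢ φ
ha a = axiom (inj₁ a)

-- Follows from `ext`: applied to the fresh variable, both weakened abstractions β-reduce to their
-- bodies.
ξ : {t u : Tm (σ ∷ Γ) τ} →
    (HAω ∪ 𝒮) ∣ map wkF Φ ⊢ t ≈ u → (HAω ∪ 𝒮) ∣ Φ ⊢ (ƛ t) ≈ (ƛ u)
ξ {t = t} {u = u} p =
  ⊃-e (ha (ext (ƛ t) (ƛ u))) (all-i (≈-trans (β-wk t) (≈-trans p (≈-sym (β-wk u)))))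
  where
  β-wk : ∀ t → (HAω ∪ _) ∣ _ ⊢ wk (ƛ t) · # 0F ≈ t
  β-wk t = subst (λ v → _ ∣ _ ⊢ wk (ƛ t) · # 0F ≈ v)
    (sub-ren-id (λ { (here refl) → refl ; (there _) → refl }) t)
    (ha (β _ (# 0F)))

η : (f : Tm Γ (σ ⇒ τ)) → (HAω ∪ 𝒮) ∣ Φ ⊢ (ƛ wk f · # 0F) ≈ f
η f = ⊃-e (ha (ext (ƛ wk f · # 0F) f)) (all-i
  (subst (λ v → _ ∣ _ ⊢ wk (ƛ wk f · # 0F) · # 0F ≈ v · # 0F)
    (sub-ren-id (λ { (here refl) → refl ; (there _) → refl }) (wk f))
    (ha (β _ (# 0F)))))

infix  1 begin_
infixr 2 _≈⟨_⟩_ _≈⟨_⟨_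
infix  3 _∎

begin_ : 𝒮 ∣ Φ ⊢ t ≈ u → 𝒮 ∣ Φ ⊢ t ≈ u
begin p = p

_≈⟨_⟩_ : (t : Tm Γ σ) → 𝒮 ∣ Φ ⊢ t ≈ u → 𝒮 ∣ Φ ⊢ u ≈ v → 𝒮 ∣ Φ ⊢ t ≈ v
_ ≈⟨ p ⟩ q = ≈-trans p q

_≈⟨_⟨_ : (t : Tm Γ σ) → 𝒮 ∣ Φ ⊢ u ≈ t → 𝒮 ∣ Φ ⊢ u ≈ v → 𝒮 ∣ Φ ⊢ t ≈ v
_ ≈⟨ p ⟨ q = ≈-trans (≈-sym p) q

_∎ : (t : Tm Γ σ) → 𝒮 ∣ Φ ⊢ t ≈ t
_ ∎ = ≈-i

-- Provable reduction: reducts are paired with a derivation, so that no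
-- separate soundness proof has to repeat the case analysis.

Reduct : Tm Γ σ → Set₁
Reduct {Γ} t = Σ[ u ∈ Tm Γ _ ] (∀ {𝒮 Φ} → (HAω ∪ 𝒮) ∣ Φ ⊢ t ≈ u)

contract : (t : Tm Γ σ) → Reduct t
contract ((ƛ t) · u)                      = _ , ha (β t u)
contract (𝔹-rec · a · b · tt)             = _ , ha (𝔹-rec-tt a b)
contract (𝔹-rec · a · b · ff)             = _ , ha (𝔹-rec-ff a b)
contract (𝕟-rec · a · f · zero)           = _ , ha (𝕟-rec-zero a f)
contract (𝕟-rec · a · f · (suc · n))      = _ , ha (𝕟-rec-suc a f n)
contract (✶-rec · a · f · nil)            = _ , ha (✶-rec-nil a f)
contract (✶-rec · a · f · (cons · x · s)) = _ , ha (✶-rec-cons a f x s)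
contract (fst · (pair · t · u))           = _ , ha (fst-pair t u)
contract (snd · (pair · t · u))           = _ , ha (snd-pair t u)
contract t                                = t , ≈-i

reduce : (t : Tm Γ σ) → Reduct t
reduce (ƛ t) with u , p ← reduce t = ƛ u , ξ p
reduce (t · u) with t′ , p ← reduce t | u′ , q ← reduce u
  with v , r ← contract (t′ · u′) = v , ≈-trans (·-cong p q) r
reduce t = t , ≈-i

reduce^ : ℕ → (t : Tm Γ σ) → Reduct t
reduce^ zero    t = t , ≈-i
reduce^ (suc n) t with u , p ← reduce t with v , q ← reduce^ n u = v , ≈-trans p q

-- The number of passes is merely large enough for all uses.
normal : Tm Γ σ → Tm Γ σ
normal t = proj₁ (reduce^ 8 t)

-- Proof by reflection: on terms built from concrete variables, checking `refl` runs both
-- reductions. Facts obtained this way are therefore quantified inside the logic and instantiated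
-- with `at`.
compute : normal t ≡ normal u → (HAω ∪ 𝒮) ∣ Φ ⊢ t ≈ u
compute {t = t} {u = u} e =
  ≈-trans (proj₂ (reduce^ 8 t))
    (≈-sym (subst (λ v → _ ∣ _ ⊢ u ≈ v) (sym e) (proj₂ (reduce^ 8 u))))

𝕟-induction : {φ : Formula (𝕟 ∷ Γ)} →
              (HAω ∪ 𝒮) ∣ Φ ⊢ φ ⟦ zero ⟧ →
              (HAω ∪ 𝒮) ∣ φ ∷ map wkF Φ ⊢ φ [ ↑¹ ∣ suc · # 0F ] →
              (HAω ∪ 𝒮) ∣ Φ ⊢ all 𝕟 φ
𝕟-induction p q = ⊃-e (⊃-e (ha (𝕟-ind _)) p) (all-i (⊃-i q))

✶-induction : {φ : Formula (σ ✶ ∷ Γ)} →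
              (HAω ∪ 𝒮) ∣ Φ ⊢ φ ⟦ nil ⟧ →
              (HAω ∪ 𝒮) ∣ wkF φ ∷ map wkF (map wkF Φ) ⊢ φ [ ↑² ∣ cons · # 0F · # 1F ] →
              (HAω ∪ 𝒮) ∣ Φ ⊢ all (σ ✶) φ
✶-induction p q = ⊃-e (⊃-e (ha (✶-ind _)) p) (all-i (⊃-i (all-i q)))

-- Sequences

-- A redex rather than an abstraction over `wk α`, so that substitution commutes with `tail`
-- definitionally.
tail : Tm Γ (𝕟 ⇒ X) → Tm Γ (𝕟 ⇒ X)
tail α = (ƛ ƛ # 1F · (suc · # 0F)) · α

drop : Tm Γ (X ✶) → Tm Γ (𝕟 ⇒ X) → Tm Γ (𝕟 ⇒ X)
drop s α = ✶-rec · (ƛ # 0F) · (ƛ ƛ ƛ ƛ # 1F · tail (# 0F)) · s · α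

tail-◂ : (HAω ∪ 𝒮) ∣ Φ ⊢ all (𝕟 ⇒ X) (all X (tail (# 0F ◂ # 1F) ≈ # 1F))
-- Computation leaves the η-expansion of `# 1F`.
tail-◂ = all-i (all-i (≈-trans (compute refl) (η (# 1F))))

++-⊛ : (HAω ∪ 𝒮) ∣ Φ ⊢ all (𝕟 ⇒ X) (all (X ✶) (all (X ✶)
         ((# 0F ++ # 1F) ⊛ # 2F ≈ # 0F ⊛ (# 1F ⊛ # 2F))))
++-⊛ = all-i (all-i (✶-induction (compute refl) (begin
  ((cons · # 0F · # 1F) ++ # 2F) ⊛ # 3F
    ≈⟨ compute refl ⟩
  # 0F ◂ ((# 1F ++ # 2F) ⊛ # 3F)
    ≈⟨ ·-congˡ _ (assume 0F) ⟩
  # 0F ◂ (# 1F ⊛ (# 2F ⊛ # 3F))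
    ≈⟨ compute refl ⟩
  (cons · # 0F · # 1F) ⊛ (# 2F ⊛ # 3F) ∎)))

++-assoc : (HAω ∪ 𝒮) ∣ Φ ⊢ all (X ✶) (all (X ✶) (all (X ✶)
             ((# 0F ++ # 1F) ++ # 2F ≈ # 0F ++ (# 1F ++ # 2F))))
++-assoc = all-i (all-i (✶-induction (compute refl) (begin
  ((cons · # 0F · # 1F) ++ # 2F) ++ # 3F
    ≈⟨ compute refl ⟩
  cons · # 0F · ((# 1F ++ # 2F) ++ # 3F)
    ≈⟨ ·-congˡ _ (assume 0F) ⟩
  cons · # 0F · (# 1F ++ (# 2F ++ # 3F))
    ≈⟨ compute refl ⟩
  (cons · # 0F · # 1F) ++ (# 2F ++ # 3F) ∎)))

++-nil : (HAω ∪ 𝒮) ∣ Φ ⊢ all (X ✶) (# 0F ++ nil ≈ # 0F)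
++-nil = ✶-induction (compute refl)
  (≈-trans (compute refl) (·-congˡ (cons · # 0F) (assume 0F)))

∷ʳ-⊛ : (HAω ∪ 𝒮) ∣ Φ ⊢ all (𝕟 ⇒ X) (all X (all (X ✶)
         ((# 0F ∷ʳ # 1F) ⊛ # 2F ≈ # 0F ⊛ (# 1F ◂ # 2F))))
∷ʳ-⊛ = all-i (all-i (all-i (≈-trans
  (++-⊛ at # 2F at cons · # 1F · nil at # 0F) (compute refl))))

drop-⊛ : (HAω ∪ 𝒮) ∣ Φ ⊢ all (𝕟 ⇒ X) (all (X ✶) (drop (# 0F) (# 0F ⊛ # 1F) ≈ # 1F))
drop-⊛ = all-i (✶-induction (compute refl) (begin
  drop (cons · # 0F · # 1F) ((cons · # 0F · # 1F) ⊛ # 2F)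
    ≈⟨ compute refl ⟩
  drop (# 1F) (tail (# 0F ◂ (# 1F ⊛ # 2F)))
    ≈⟨ ·-congˡ _ (tail-◂ at # 1F ⊛ # 2F at # 0F) ⟩
  drop (# 1F) (# 1F ⊛ # 2F)
    ≈⟨ assume 0F ⟩
  # 2F ∎))

-- `initial` grows at its end, whereas `⊛` recurses from the front; this converts between the two.
initial-suc : (HAω ∪ 𝒮) ∣ Φ ⊢ all (𝕟 ⇒ X) (all 𝕟
                (initial (# 1F) (suc · # 0F) ≈
                 cons · (# 1F · zero) · initial (tail (# 1F)) (# 0F)))
initial-suc = all-i (𝕟-induction (compute refl) (begin
  initial (# 1F) (suc · (suc · # 0F))
    ≈⟨ compute refl ⟩
  initial (# 1F) (suc · # 0F) ∷ʳ (# 1F · (suc · # 0F))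
    ≈⟨ ·-congˡ _ (assume 0F) ⟩
  (cons · (# 1F · zero) · initial (tail (# 1F)) (# 0F)) ∷ʳ (# 1F · (suc · # 0F))
    ≈⟨ compute refl ⟩
  cons · (# 1F · zero) · initial (tail (# 1F)) (suc · # 0F) ∎))

-- Supplies the premise of `CONT`. The sequence whose initial segment is taken is quantified
-- innermost, as the induction hypothesis is used at its tail.
initial-⊛ : (HAω ∪ 𝒮) ∣ Φ ⊢ all (𝕟 ⇒ X) (all 𝕟 (all (𝕟 ⇒ X)
              (initial (initial (# 0F) (# 1F) ⊛ # 2F) (# 1F) ≈ initial (# 0F) (# 1F))))
initial-⊛ = all-i (𝕟-induction (all-i (compute refl)) (all-i (
  let α = # 0F ; n = # 1F ; δ = # 2F in begin
  initial (initial α (suc · n) ⊛ δ) (suc · n)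
    ≈⟨ ≈-cong (initial (# 0F ⊛ # 3F) (suc · # 2F)) (initial-suc at α at n) ⟩
  initial ((cons · (α · zero) · initial (tail α) n) ⊛ δ) (suc · n)
    ≈⟨ initial-suc at ((cons · (α · zero) · initial (tail α) n) ⊛ δ) at n ⟩
  cons · (((cons · (α · zero) · initial (tail α) n) ⊛ δ) · zero)
       · initial (tail ((cons · (α · zero) · initial (tail α) n) ⊛ δ)) n
    ≈⟨ compute refl ⟩
  cons · (α · zero) · initial (tail ((α · zero) ◂ (initial (tail α) n ⊛ δ))) n
    ≈⟨ ≈-cong (cons · (# 1F · zero) · initial (# 0F) (# 2F))
         (tail-◂ at initial (tail α) n ⊛ δ at α · zero) ⟩
  cons · (α · zero) · initial (initial (tail α) n ⊛ δ) n
    ≈⟨ ·-congˡ _ (assume 0F at tail α) ⟩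
  cons · (α · zero) · initial (tail α) n
    ≈⟨ initial-suc at α at n ⟨
  initial α (suc · n) ∎)))

-- MBR′ from MBR

_after✶_ : Tm Γ ((𝕟 ⇒ X) ⇒ R) → Tm Γ (X ✶) → Tm Γ ((𝕟 ⇒ X) ⇒ R)
q after✶ s = ƛ wk q · (wk s ⊛ # 0F)

MBR′-from-MBR : (p : Types) → Tm [] (BRType p ⇒ BRType p)
MBR′-from-MBR (types X R _) =
  ƛ ƛ ƛ ƛ # 2F ⊛ (# 3F · # 2F · # 1F · (# 0F after✶ # 2F))

MBR≥MBR′ : MBR ≥T MBR′ over (HAω ∪ 𝒮)
MBR≥MBR′ p = p , MBR′-from-MBR p , all-i (all-i (all-i (begin
  b · # 3F · # 2F · # 1F · # 0F
    ≈⟨ compute refl ⟩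
  # 2F ⊛ (# 3F · # 2F · # 1F · (# 0F after✶ # 2F))
    ≈⟨ ≈-cong (# 3F ⊛ # 0F) (assume 0F at # 2F at # 1F at # 0F after✶ # 2F) ⟩
  # 2F ⊛ (# 1F · # 2F · (ƛ ((# 1F after✶ # 3F) after # 0F) ·
    (# 4F · (# 3F ∷ʳ # 0F) · # 2F · ((# 1F after✶ # 3F) after # 0F))))
    ≈⟨ ≈-cong (# 3F ⊛ (# 2F · # 3F · # 0F)) (ξ unfold) ⟩
  # 2F ⊛ (# 1F · # 2F · (ƛ # 1F · (b · # 4F · (# 3F ∷ʳ # 0F) · # 2F · # 1F))) ∎)))
  where
  b : Tm Γ (BRType p ⇒ BRType p)
  b = closed (MBR′-from-MBR p)

  unfold = let s = # 3F ∷ʳ # 0F in begin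
    ((# 1F after✶ # 3F) after # 0F) ·
      (# 4F · s · # 2F · ((# 1F after✶ # 3F) after # 0F))
      -- The two outcome functions agree pointwise by `∷ʳ-⊛`, hence `ξ`; both occurrences are
      -- rewritten at once.
      ≈⟨ ≈-cong (# 0F · (# 5F · (# 4F ∷ʳ # 1F) · # 3F · # 0F)) (≈-trans
           (compute refl) (ξ (·-congˡ (# 2F) (≈-sym (∷ʳ-⊛ at # 0F at # 1F at # 4F))))) ⟩
    (# 1F after✶ s) · (# 4F · s · # 2F · (# 1F after✶ s))
      ≈⟨ compute refl ⟩
    # 1F · (b · # 4F · s · # 2F · # 1F) ∎

-- MBR from MBR′

module _ (X R : Ty) (R-discrete : Discrete R) where

  private
    p         = types X R R-discrete
    Selection = X ✶ ⇒ (X ⇒ R) ⇒ (𝕟 ⇒ X)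
    Outcome   = (𝕟 ⇒ X) ⇒ R

  -- The defining equation gives a value `s ⊛ α`, and `drop-⊛` recovers `α`. Naming the remainder by
  -- `drop` avoids an existential quantifier.
  MBR′-extends : (HAω ∪ 𝒮) ∣ Φ ⊢ equation MBR′ p →
                 (HAω ∪ 𝒮) ∣ Φ ⊢ all (X ✶) (all Selection (all Outcome
                   (let b = # 3F · # 2F · # 1F · # 0F in
                    b ≈ # 2F ⊛ drop (# 2F) b)))
  MBR′-extends eq = cut eq (all-i (all-i (all-i (
    let b = # 3F · # 2F · # 1F · # 0F
        α = # 1F · # 2F · (ƛ # 1F · (# 4F · (# 3F ∷ʳ # 0F) · # 2F · # 1F)) in begin
    b
      ≈⟨ assume 0F at # 2F at # 1F at # 0F ⟩
    # 2F ⊛ α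
      ≈⟨ ≈-cong (# 3F ⊛ # 0F) (drop-⊛ at α at # 2F) ⟨
    # 2F ⊛ drop (# 2F) (# 2F ⊛ α)
      ≈⟨ ≈-cong (# 3F ⊛ drop (# 3F) (# 0F)) (assume 0F at # 2F at # 1F at # 0F) ⟨
    # 2F ⊛ drop (# 2F) b ∎))))

  -- Splitting off the first prefix lets `Agree` apply; splitting off the second lets the modulus of
  -- continuity apply.
  Extends : Formula (BRType p ∷ [])
  Extends = all (X ✶) (all Selection (all Outcome (all (X ✶) (all X
    (let s = (# 4F ++ # 1F) ∷ʳ # 0F
         b = # 5F · s · # 3F · # 2F in
     b ≈ # 4F ⊛ (# 1F ⊛ (# 0F ◂ drop s b)))))))

  MBR′-extends-++ : (HAω ∪ 𝒮) ∣ Φ ⊢ equation MBR′ p → (HAω ∪ 𝒮) ∣ Φ ⊢ Extends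
  MBR′-extends-++ eq = cut (MBR′-extends eq) (all-i (all-i (all-i (all-i (all-i (
    let s = (# 4F ++ # 1F) ∷ʳ # 0F
        b = # 5F · s · # 3F · # 2F in begin
    b
      ≈⟨ assume 0F at s at # 3F at # 2F ⟩
    s ⊛ drop s b
      ≈⟨ ∷ʳ-⊛ at drop s b at # 0F at # 4F ++ # 1F ⟩
    (# 4F ++ # 1F) ⊛ (# 0F ◂ drop s b)
      ≈⟨ ++-⊛ at # 0F ◂ drop s b at # 1F at # 4F ⟩
    # 4F ⊛ (# 1F ⊛ (# 0F ◂ drop s b)) ∎))))))

  Step : Formula (BRType p ∷ [])
  Step = all (X ✶) (all Selection (all Outcome (all Outcome
    (all X (# 2F · (# 5F · (# 4F ∷ʳ # 0F) · # 3F · # 2F) ≈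
            # 1F · (# 5F · (# 4F ∷ʳ # 0F) · # 3F · # 1F)) ⊃
     # 4F · # 3F · # 2F · # 1F ≈ # 4F · # 3F · # 2F · # 0F))))

  -- The right-hand side of the equation depends on the outcome function only through the function
  -- of `x` that is passed to the selection, so `ξ` suffices.
  MBR′-step : (HAω ∪ 𝒮) ∣ Φ ⊢ equation MBR′ p → (HAω ∪ 𝒮) ∣ Φ ⊢ Step
  MBR′-step eq = cut eq (all-i (all-i (all-i (all-i (⊃-i (begin
    # 4F · # 3F · # 2F · # 1F
      ≈⟨ assume 1F at # 3F at # 2F at # 1F ⟩
    # 3F ⊛ (# 2F · # 3F · (ƛ # 2F · (# 5F · (# 4F ∷ʳ # 0F) · # 3F · # 2F)))
      ≈⟨ ≈-cong (# 4F ⊛ (# 3F · # 4F · # 0F)) (ξ (assume 0F at # 0F)) ⟩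
    # 3F ⊛ (# 2F · # 3F · (ƛ # 1F · (# 5F · (# 4F ∷ʳ # 0F) · # 3F · # 1F)))
      ≈⟨ assume 1F at # 3F at # 2F at # 0F ⟨
    # 4F · # 3F · # 2F · # 0F ∎))))))

  Agree : Formula (Outcome ∷ Outcome ∷ Selection ∷ X ✶ ∷ BRType p ∷ [])
  Agree = all (𝕟 ⇒ X) (# 2F · (# 4F ⊛ # 0F) ≈ # 1F · (# 4F ⊛ # 0F))

  Same : Formula (X ✶ ∷ Outcome ∷ Outcome ∷ Selection ∷ X ✶ ∷ BRType p ∷ [])
  Same = # 5F · (# 4F ++ # 0F) · # 3F · # 2F ≈ # 5F · (# 4F ++ # 0F) · # 3F · # 1F

  private
    hyps : List (Formula (Outcome ∷ Outcome ∷ Selection ∷ X ✶ ∷ BRType p ∷ []))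
    hyps = Agree ∷ map wkF (map wkF (map wkF (map wkF
             (Step ∷ Extends ∷ equation MBR′ p ∷ []))))

  same-bar : (HAω ∪ BI ∪ CONT) ∣ all 𝕟 (zero ≈ zero) ∷ map wkF hyps ⊢
             ex 𝕟 (Same [ ↑² ∣ initial (# 1F) (# 0F) ])
  same-bar = ex-e
    -- Continuity is applied to `q_t` instead of `q`, so that the modulus counts entries after the
    -- fixed prefix `t`.
    (axiom (inj₂ (inj₂ (cont R-discrete))) at # 2F after✶ # 4F at # 0F)
    (ex-i (# 0F) (cut {φ = all (𝕟 ⇒ X) (
       # 4F · (# 6F ⊛ (initial (# 2F) (# 1F) ⊛ # 0F)) ≈ (# 4F after✶ # 6F) · # 2F)}
     (all-i (begin
       # 4F · (# 6F ⊛ (initial (# 2F) (# 1F) ⊛ # 0F))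
         ≈⟨ compute refl ⟩
       (# 4F after✶ # 6F) · (initial (# 2F) (# 1F) ⊛ # 0F)
         ≈⟨ ⊃-e (assume 0F at initial (# 2F) (# 1F) ⊛ # 0F)
              (≈-sym (initial-⊛ at # 0F at # 1F at # 2F)) ⟨
       (# 4F after✶ # 6F) · # 2F ∎))
     (⊃-e (assume 4F at # 5F ++ initial (# 1F) (# 0F) at # 4F at # 3F at # 2F)
       (all-i (
         let u = initial (# 2F) (# 1F)
             s = (# 6F ++ u) ∷ʳ # 0F
             b  = # 7F · s · # 5F · # 4F
             b′ = # 7F · s · # 5F · # 3F in begin
         # 4F · b
           ≈⟨ ·-congˡ _ (assume 5F at # 6F at # 5F at # 4F at u at # 0F) ⟩
         # 4F · (# 6F ⊛ (u ⊛ (# 0F ◂ drop s b)))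
           -- `b` and `b′` may differ beyond `s`. Constancy of `q` on extensions of `t ++ u` sends
           -- both to one value; only then does `Agree` exchange `q` for `q′`.
           ≈⟨ assume 0F at # 0F ◂ drop s b ⟩
         (# 4F after✶ # 6F) · # 2F
           ≈⟨ assume 0F at # 0F ◂ drop s b′ ⟨
         # 4F · (# 6F ⊛ (u ⊛ (# 0F ◂ drop s b′)))
           ≈⟨ assume 3F at u ⊛ (# 0F ◂ drop s b′) ⟩
         # 3F · (# 6F ⊛ (u ⊛ (# 0F ◂ drop s b′)))
           ≈⟨ ·-congˡ _ (assume 5F at # 6F at # 5F at # 3F at u at # 0F) ⟨
         # 3F · b′ ∎)))))

  -- By `Step` it is enough to compare outcomes at each `x`. `Agree` exchanges the outer `q`, whose
  -- argument extends `t`, and the hypothesis at `u ∷ʳ x` exchanges the `q` inside the recursive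
  -- call.
  same-hereditary : (HAω ∪ BI ∪ CONT) ∣
    all X (zero ≈ zero ⊃ Same [ ↑² ∣ # 1F ∷ʳ # 0F ]) ∷ zero ≈ zero ∷ map wkF hyps ⊢ Same
  same-hereditary =
    ⊃-e (assume 3F at # 4F ++ # 0F at # 3F at # 2F at # 1F) (all-i (
      let s = (# 5F ++ # 1F) ∷ʳ # 0F
          b  = # 6F · s · # 4F · # 3F
          assoc = ++-assoc at cons · # 0F · nil at # 1F at # 5F in begin
      # 3F · b
        ≈⟨ ·-congˡ _ (assume 4F at # 5F at # 4F at # 3F at # 1F at # 0F) ⟩
      # 3F · (# 5F ⊛ (# 1F ⊛ (# 0F ◂ drop s b)))
        ≈⟨ assume 2F at # 1F ⊛ (# 0F ◂ drop s b) ⟩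
      # 2F · (# 5F ⊛ (# 1F ⊛ (# 0F ◂ drop s b)))
        ≈⟨ ·-congˡ _ (assume 4F at # 5F at # 4F at # 3F at # 1F at # 0F) ⟨
      # 2F · b
        ≈⟨ ≈-cong (# 3F · (# 7F · # 0F · # 5F · # 4F)) assoc ⟩
      # 2F · (# 6F · (# 5F ++ (# 1F ∷ʳ # 0F)) · # 4F · # 3F)
        ≈⟨ ·-congˡ _ (⊃-e (assume 0F at # 0F) ≈-i) ⟩
      # 2F · (# 6F · (# 5F ++ (# 1F ∷ʳ # 0F)) · # 4F · # 2F)
        ≈⟨ ≈-cong (# 3F · (# 7F · # 0F · # 5F · # 3F)) assoc ⟨
      # 2F · (# 6F · s · # 4F · # 2F) ∎))

  Local : Formula (BRType p ∷ [])
  Local = all (X ✶) (all Selection (all Outcome (all Outcome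
    (Agree ⊃ # 4F · # 3F · # 2F · # 1F ≈ # 4F · # 3F · # 2F · # 0F))))

  -- Bar induction on the predicate F (t ++ u) ε q ≈ F (t ++ u) ε q′ of u: the
  -- recursion only evaluates q and q′ at extensions of t ++ u, where both are
  -- constant as soon as u is long enough for the modulus of α ↦ q (t ⊛ α).
  MBR′-local : (HAω ∪ BI ∪ CONT) ∣ equation MBR′ p ∷ [] ⊢ Local
  MBR′-local = cut (MBR′-extends-++ (assume 0F)) (cut (MBR′-step (assume 1F))
    (all-i (all-i (all-i (all-i (⊃-i (begin
      # 4F · # 3F · # 2F · # 1F
        ≈⟨ ≈-cong (# 5F · # 0F · # 3F · # 2F) (++-nil at # 3F) ⟨
      # 4F · (# 3F ++ nil) · # 2F · # 1F
        -- The trivially true `zero ≈ zero` as `S` admits every sequence. The conclusion is about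
        -- `nil`, whence the two uses of `++-nil`.
        ≈⟨ ⊃-e (⊃-e (⊃-e (axiom (inj₂ (inj₁ (bi (zero ≈ zero) Same)))) ≈-i)
             (all-i (⊃-i same-bar))) (all-i (⊃-i (⊃-i same-hereditary))) ⟩
      # 4F · (# 3F ++ nil) · # 2F · # 0F
        ≈⟨ ≈-cong (# 5F · # 0F · # 3F · # 1F) (++-nil at # 3F) ⟩
      # 4F · # 3F · # 2F · # 0F ∎)))))))

-- The equation of `MBR`

_∘drop_ : Tm Γ ((𝕟 ⇒ X) ⇒ R) → Tm Γ (X ✶) → Tm Γ ((𝕟 ⇒ X) ⇒ R)
q ∘drop s = ƛ wk q · drop (wk s) (# 0F)

-- Both sides are `q (x ◂ α)`: on the left `x` survives the drop, on the right it is dropped and put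
-- back by `after`.
∘drop-∷ʳ : (HAω ∪ 𝒮) ∣ Φ ⊢ all ((𝕟 ⇒ X) ⇒ R) (all (X ✶) (all X (all (𝕟 ⇒ X)
             ((# 3F ∘drop # 2F) · ((# 2F ∷ʳ # 1F) ⊛ # 0F) ≈
              ((# 3F after # 1F) ∘drop (# 2F ∷ʳ # 1F)) · ((# 2F ∷ʳ # 1F) ⊛ # 0F)))))
∘drop-∷ʳ = all-i (all-i (all-i (all-i (let s = # 2F ∷ʳ # 1F in begin
  (# 3F ∘drop # 2F) · (s ⊛ # 0F)
    ≈⟨ ·-congˡ _ (∷ʳ-⊛ at # 0F at # 1F at # 2F) ⟩
  (# 3F ∘drop # 2F) · (# 2F ⊛ (# 1F ◂ # 0F))
    ≈⟨ compute refl ⟩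
  # 3F · drop (# 2F) (# 2F ⊛ (# 1F ◂ # 0F))
    ≈⟨ ·-congˡ _ (drop-⊛ at # 1F ◂ # 0F at # 2F) ⟩
  # 3F · (# 1F ◂ # 0F)
    ≈⟨ compute refl ⟩
  (# 3F after # 1F) · # 0F
    ≈⟨ ·-congˡ _ (drop-⊛ at # 0F at s) ⟨
  (# 3F after # 1F) · drop s (s ⊛ # 0F)
    ≈⟨ compute refl ⟩
  ((# 3F after # 1F) ∘drop s) · (s ⊛ # 0F) ∎))))

MBR-from-MBR′ : (p : Types) → Tm [] (BRType p ⇒ BRType p)
MBR-from-MBR′ (types X R _) =
  ƛ ƛ ƛ ƛ drop (# 2F) (# 3F · # 2F · # 1F · (# 0F ∘drop # 2F))

MBR′≥MBR : MBR′ ≥T MBR over (HAω ∪ BI ∪ CONT)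
MBR′≥MBR p@(types X R R-discrete) = p , MBR-from-MBR′ p ,
  cut (MBR′-local X R R-discrete) (cut (MBR′-extends X R R-discrete (assume 1F))
    (all-i (all-i (all-i (
      let α = # 1F · # 2F · (ƛ (# 1F ∘drop # 3F) ·
                (# 4F · (# 3F ∷ʳ # 0F) · # 2F · (# 1F ∘drop # 3F))) in begin
      b · # 3F · # 2F · # 1F · # 0F
        ≈⟨ compute refl ⟩
      drop (# 2F) (# 3F · # 2F · # 1F · (# 0F ∘drop # 2F))
        ≈⟨ ≈-cong (drop (# 3F) (# 0F)) (assume 2F at # 2F at # 1F at # 0F ∘drop # 2F) ⟩
      drop (# 2F) (# 2F ⊛ α)
        ≈⟨ drop-⊛ at α at # 2F ⟩
      α
        ≈⟨ ·-congˡ _ (ξ (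
             let s  = # 3F ∷ʳ # 0F
                 q  = # 1F ∘drop # 3F
                 q′ = (# 1F after # 0F) ∘drop s
                 c  = # 4F · s · # 2F · q′
                 agree = ∘drop-∷ʳ at # 1F at # 3F at # 0F in begin
             q · (# 4F · s · # 2F · q)
               -- Locality exchanges the inner `q` for `q′`.
               ≈⟨ ·-congˡ q (⊃-e (assume 1F at s at # 2F at q at q′) agree) ⟩
             q · c
               -- The outer exchange needs `c` displayed as an extension of `s`, since `agree`
               -- covers only such arguments.
               ≈⟨ ·-congˡ q (assume 0F at s at # 2F at q′) ⟩
             q · (s ⊛ drop s c)
               ≈⟨ agree at drop s c ⟩
             q′ · (s ⊛ drop s c)
               ≈⟨ ·-congˡ q′ (assume 0F at s at # 2F at q′) ⟨
             q′ · c
               ≈⟨ compute refl ⟩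
             (# 1F after # 0F) · (b · # 4F · s · # 2F · (# 1F after # 0F)) ∎)) ⟩
      # 1F · # 2F · (ƛ (# 1F after # 0F) ·
        (b · # 4F · (# 3F ∷ʳ # 0F) · # 2F · (# 1F after # 0F))) ∎)))))
  where
  b : Tm Γ (BRType p ⇒ BRType p)
  b = closed (MBR-from-MBR′ p)

theorem4p10 : MBR =T MBR′ over (HAω ∪ BI ∪ CONT)
theorem4p10 = MBR≥MBR′ , MBR′≥MBR
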